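{- Let $\{a_0,a_1,\ldots\}$ and $\{b_0,b_1,\ldots\}$ be sequences of (complex) numbers such that $a_0=b_0=1$ and such that for all integers $n\ge 0$ $$\sum_{h=0}^{n} a_{n-h}\,b_h=\delta_{0,n},$$ where $\delta_{0,n}$ is $1$ if $n=0$ and $0$ otherwise. Then for every integer $n>0$ both of the following formulas hold: $$b_n=\sum_{c\in\mathcal{C}(n)}\ \prod_{n_i\in c}\left(-a_{n_i}\right),$$ $$b_n=\sum_{p\in\mathcal{P}(n)}\mu(p)\prod_{n_i\in p}\left(-a_{n_i}\right),$$ where $\mathcal{C}(n)$ is the set of all compositions of $n$, $\mathcal{P}(n)$ is the set of all partitions of $n$, $\mu(p)=l(p)!\big/\prod_{j} m_p(j)!$ with $j$ running over the distinct parts of $p$, and products over $n_i\in c$ or $n_i\in p$ are taken over all parts, counted with multiplicity.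
   Context: Let $n$ be a positive integer. A composition $c$ of $n$ is a finite sequence $(n_1,n_2,\ldots,n_{l(c)})$ of positive integers with $\sum_{i=1}^{l(c)} n_i=n$; sequences that differ in the order of their terms are different compositions. The number $l(c)$ is the length of $c$. A partition $p$ of $n$ is a composition $(n_1,\ldots,n_{l(p)})$ of $n$ whose terms (parts) are in weakly decreasing order, $n_i\ge n_{i+1}$; $l(p)$ is its length, i.e. its number of parts counted with repetition. For a positive integer $j$, $m_p(j)$ denotes the multiplicity of $j$ in $p$, i.e. the number of times $j$ appears as a part of $p$. The number $\mu(p)=l(p)!\big/\prod_j m_p(j)!$ (product over the distinct parts $j$ of $p$) is the number of different compositions formed by the same numbers as in the partition $p$. $\mathcal{C}(n)$ and $\mathcal{P}(n)$ denote the set of all compositions and the set of all partitions of $n$, respectively. -}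

module Defs where

open import Algebra.Bundles using (CommutativeRing)
open import Data.Bool.Base using (if_then_else_)
open import Data.Empty using (⊥)
open import Data.List.Base using (List; []; _∷_; [_]; _++_; map; foldr; filter; length; deduplicate)
open import Data.List.Membership.Propositional using (_∈_)
open import Data.List.Membership.Propositional.Properties
  using (∈-++⁺ˡ; ∈-++⁺ʳ; ∈-++⁻; ∈-map⁺; ∈-map⁻; ∈-filter⁺; ∈-filter⁻)
open import Data.List.Relation.Unary.All as All using (All; []; _∷_)
open import Data.List.Relation.Unary.All.Properties as All using ()
open import Data.List.Relation.Unary.AllPairs using ([]; _∷_)
open import Data.List.Relation.Unary.Any using (here; there)
open import Data.List.Relation.Unary.Linked using (Linked; linked?)
open import Data.List.Relation.Unary.Unique.Propositional using (Unique)
import Data.List.Relation.Unary.Unique.Propositional.Properties as Unique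
open import Data.List.Properties using (∷-injectiveʳ)
open import Data.Nat.Base
open import Data.Nat.ListAction using (sum; product)
open import Data.Nat.ListAction.Properties using (product≢0)
open import Data.Nat.Properties
open import Data.Product.Base using (_×_; _,_; ∃₂)
open import Data.Sum.Base using (inj₁; inj₂)
open import Relation.Binary.PropositionalEquality using (_≡_; refl; sym; trans; cong; subst)
open import Relation.Nullary.Decidable.Core using (does)
open import Relation.Nullary.Negation.Core using (contradiction)

record IsComposition (n : ℕ) (c : List ℕ) : Set where
  constructor isComposition
  field
    positive : All (0 <_) c
    total    : sum c ≡ n

record IsPartition (n : ℕ) (p : List ℕ) : Set where
  constructor isPartition
  field
    composition : IsComposition n p
    decreasing  : Linked _≥_ p

-- The finite set { c ∣ P c }, presented as a list containing each of its
-- elements exactly once.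
record FiniteSet (P : List ℕ → Set) : Set where
  field
    elements : List (List ℕ)
    unique   : Unique elements
    sound    : ∀ {c} → c ∈ elements → P c
    complete : ∀ {c} → P c → c ∈ elements

open FiniteSet public

-- The compositions of 1 + k + m whose first part exceeds k.
compositionsFrom : (k m : ℕ) → List (List ℕ)
compositionsFrom k zero    = [ [ suc k ] ]
compositionsFrom k (suc m) =
  map (suc k ∷_) (compositionsFrom 0 m) ++ compositionsFrom (suc k) m

compositionList : ℕ → List (List ℕ)
compositionList zero    = [ [] ]
compositionList (suc n) = compositionsFrom 0 n

private
  headAbove : ∀ k m {c} → c ∈ compositionsFrom k m →
              ∃₂ λ x xs → c ≡ x ∷ xs × k < x
  headAbove k zero    (here refl) = suc k , [] , refl , ≤-refl
  headAbove k (suc m) c∈ with ∈-++⁻ (map (suc k ∷_) (compositionsFrom 0 m)) c∈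
  ... | inj₁ c∈ˡ with d , _ , refl ← ∈-map⁻ (suc k ∷_) c∈ˡ = suc k , d , refl , ≤-refl
  ... | inj₂ c∈ʳ with x , xs , eq , k<x ← headAbove (suc k) m c∈ʳ =
    x , xs , eq , <-trans (n<1+n k) k<x

  from-sound : ∀ k m {c} → c ∈ compositionsFrom k m → IsComposition (suc k + m) c
  from-sound k zero (here refl) = isComposition (z<s ∷ []) refl
  from-sound k (suc m) {c} c∈ with ∈-++⁻ (map (suc k ∷_) (compositionsFrom 0 m)) c∈
  ... | inj₁ c∈ˡ with d , d∈ , refl ← ∈-map⁻ (suc k ∷_) c∈ˡ
                 with isComposition pos eq ← from-sound 0 m d∈ =
    isComposition (z<s ∷ pos) (cong (suc k +_) eq)
  ... | inj₂ c∈ʳ = subst (λ n → IsComposition n c) (sym (cong suc (+-suc k m)))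
                     (from-sound (suc k) m c∈ʳ)

  sum≡0⇒[] : ∀ {c} → All (0 <_) c → sum c ≡ 0 → c ≡ []
  sum≡0⇒[] []            _ = refl
  sum≡0⇒[] (s≤s _ ∷ _) ()

  from-complete : ∀ k m {x xs} → k < x → All (0 <_) xs → x + sum xs ≡ suc k + m →
                  (x ∷ xs) ∈ compositionsFrom k m
  from-complete k m {x} {xs} k<x pos eq with m≤n⇒m<n∨m≡n k<x
  from-complete k zero {xs = xs} _ pos eq | inj₂ refl
    with refl ← sum≡0⇒[] pos (+-cancelˡ-≡ (suc k) (sum xs) 0 eq) = here refl
  from-complete k (suc m) {xs = []} _ pos eq | inj₂ refl
    with () ← +-cancelˡ-≡ (suc k) 0 (suc m) eq
  from-complete k (suc m) {xs = y ∷ ys} _ (0<y ∷ pos) eq | inj₂ refl =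
    ∈-++⁺ˡ (∈-map⁺ (suc k ∷_)
      (from-complete 0 m 0<y pos (+-cancelˡ-≡ (suc k) (y + sum ys) (suc m) eq)))
  from-complete k zero {x} {xs} _ pos eq | inj₁ k+1<x =
    contradiction (≤-trans (m≤m+n x (sum xs)) (≤-reflexive (trans eq (+-identityʳ (suc k)))))
                  (<⇒≱ k+1<x)
  from-complete k (suc m) _ pos eq | inj₁ k+1<x =
    ∈-++⁺ʳ (map (suc k ∷_) (compositionsFrom 0 m))
      (from-complete (suc k) m k+1<x pos (trans eq (cong suc (+-suc k m))))

  from-unique : ∀ k m → Unique (compositionsFrom k m)
  from-unique k zero    = [] ∷ []
  from-unique k (suc m) =
    Unique.++⁺ (Unique.map⁺ ∷-injectiveʳ (from-unique 0 m)) (from-unique (suc k) m) disjoint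
    where
    disjoint : ∀ {c} → c ∈ map (suc k ∷_) (compositionsFrom 0 m) ×
                       c ∈ compositionsFrom (suc k) m → ⊥
    disjoint (c∈ˡ , c∈ʳ) with ∈-map⁻ (suc k ∷_) c∈ˡ | headAbove (suc k) m c∈ʳ
    ... | _ , _ , refl | _ , _ , refl , k+1<k+1 = <-irrefl refl k+1<k+1

  list-unique : ∀ n → Unique (compositionList n)
  list-unique zero    = [] ∷ []
  list-unique (suc n) = from-unique 0 n

  list-sound : ∀ n {c} → c ∈ compositionList n → IsComposition n c
  list-sound zero    (here refl) = isComposition [] refl
  list-sound (suc n) c∈          = from-sound 0 n c∈

  list-complete : ∀ n {c} → IsComposition n c → c ∈ compositionList n
  list-complete zero    (isComposition pos eq) = here (sum≡0⇒[] pos eq)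
  list-complete (suc n) {x ∷ xs} (isComposition (0<x ∷ pos) eq) = from-complete 0 n 0<x pos eq

compositions : (n : ℕ) → FiniteSet (IsComposition n)
compositions n = record
  { elements = compositionList n
  ; unique   = list-unique n
  ; sound    = list-sound n
  ; complete = list-complete n
  }

partitions : (n : ℕ) → FiniteSet (IsPartition n)
partitions n = record
  { elements = filter (linked? _≥?_) (compositionList n)
  ; unique   = Unique.filter⁺ (linked? _≥?_) (list-unique n)
  ; sound    = λ p∈ → let p∈′ , dec = ∈-filter⁻ (linked? _≥?_) p∈ in
                      isPartition (list-sound n p∈′) dec
  ; complete = λ (isPartition comp dec) →
                 ∈-filter⁺ (linked? _≥?_) (list-complete n comp) dec
  }

multiplicity : List ℕ → ℕ → ℕ
multiplicity p j = length (filter (j ≟_) p)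

distinctParts : List ℕ → List ℕ
distinctParts = deduplicate _≟_

multiplicityFactorials : List ℕ → ℕ
multiplicityFactorials p = product (map (λ j → multiplicity p j !) (distinctParts p))

multiplicityFactorials≢0 : ∀ p → NonZero (multiplicityFactorials p)
multiplicityFactorials≢0 p =
  product≢0 (All.map⁺ (All.universal (λ j → multiplicity p j !≢0) (distinctParts p)))

-- The quotient is a multinomial coefficient, so the integer division is exact.
μ : List ℕ → ℕ
μ p = length p ! / multiplicityFactorials p
  where instance _ = multiplicityFactorials≢0 p

module _ {c ℓ} (R : CommutativeRing c ℓ) where

  open CommutativeRing R using (Carrier; 0#; 1#; -_) renaming (_+_ to _⊕_; _*_ to _⊛_)

  δ : ℕ → ℕ → Carrier
  δ i j = if does (i ≟ j) then 1# else 0#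

  sumOver : ∀ {P} → FiniteSet P → (List ℕ → Carrier) → Carrier
  sumOver S f = foldr _⊕_ 0# (map f (elements S))

  productOver : List ℕ → (ℕ → Carrier) → Carrier
  productOver c f = foldr _⊛_ 1# (map f c)

{-# OPTIONS --safe #-}
-- The sum B n over the compositions of n satisfies B (n + 1) = Σ_{h ≤ n} (- a (n + 1 - h)) B h,
-- by splitting off the first part; the hypothesis says that b satisfies the same recursion.
-- For partitions, the compositions of n are grouped by their decreasing rearrangement p.
-- The N(p) distinct rearrangements of p satisfy N(p) ∏ⱼ mₚ(j)! = l(p)!, by induction on the
-- length: choosing the first part x gives N(p) = Σₓ N(p - x), and
-- ∏ⱼ mₚ(j)! = mₚ(x) ∏ⱼ mₚ₋ₓ(j)!, while Σₓ mₚ(x) = l(p).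
module Submission where

open import Defs
open import Algebra.Bundles using (CommutativeMonoid; CommutativeRing)
import Algebra.Properties.AbelianGroup as AbelianGroupProperties
import Algebra.Properties.CommutativeSemigroup as CommutativeSemigroupProperties
import Algebra.Properties.Ring as RingProperties
open import Algebra.Properties.Semiring.Sum as Sum using ()
open import Algebra.Properties.Semiring.Mult as Mult using ()
open import Data.Fin.Base using (toℕ)
open import Data.Fin.Properties using (toℕ-fromℕ; toℕ-inject₁; toℕ≤pred[n])
open import Data.List.Base using (List; []; _∷_; _++_; [_]; concatMap; filter; foldr; length; map)
open import Data.List.Membership.Propositional using (_∈_; _∉_; find; lose)
open import Data.List.Membership.Propositional.Properties
  using (∈-concatMap⁺; ∈-concatMap⁻; ∈-map⁺; ∈-map⁻; ∈-deduplicate⁺; ∈-deduplicate⁻;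
         ∈-filter⁻)
open import Data.List.Membership.Propositional.Properties.WithK using (unique∧set⇒bag)
open import Data.List.Properties
  using (∷-injectiveˡ; ∷-injectiveʳ; filter-accept; filter-reject; filter-all; filter-none;
         length-++; length-map)
open import Data.List.Relation.Binary.BagAndSetEquality using (∼bag⇒↭)
open import Data.List.Relation.Binary.Permutation.Propositional
  using (_↭_; ↭-refl; ↭-sym; ↭⇒↭ₛ; prep; swap; refl; trans)
open import Data.List.Relation.Binary.Permutation.Propositional.Properties
  using (All-resp-↭; ∈-resp-↭; drop-∷; filter-↭; ↭-length)
open import Data.List.Relation.Binary.Pointwise using (Pointwise-≡⇒≡)
open import Data.List.Relation.Unary.All as All using ([]; _∷_)
open import Data.List.Relation.Unary.All.Properties using (¬Any⇒All¬)
open import Data.List.Relation.Unary.AllPairs using ([]; _∷_)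
open import Data.List.Relation.Unary.Any using (here; there)
open import Data.List.Relation.Unary.Linked using (Linked)
open import Data.List.Relation.Unary.Sorted.TotalOrder.Properties using (↗↭↗⇒≋)
open import Data.List.Relation.Unary.Unique.DecPropositional.Properties using (deduplicate-!)
open import Data.List.Relation.Unary.Unique.Propositional using (Unique)
import Data.List.Relation.Unary.Unique.Propositional.Properties as Unique
import Data.List.Sort as Sort
open import Data.Nat.Base using (ℕ; zero; suc; _∸_; _>_; _≤_; _≥_; _!; s≤s)
import Data.Nat.Base as ℕ
open import Data.Nat.DivMod using (/-congˡ; m*n/n≡m)
open import Data.Nat.Induction using (<-rec)
open import Data.Nat.ListAction using (sum)
open import Data.Nat.ListAction.Properties using (sum-↭)
open import Data.Nat.Properties
  using (_≟_; ≤-decTotalOrder; +-0-commutativeMonoid; *-1-commutativeMonoid; suc-injective;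
         n∸n≡0; +-∸-assoc; +-suc)
import Data.Nat.Properties as ℕ
open import Data.Product.Base using (_×_; _,_; proj₂)
open import Function.Base using (_∘_; _$_)
open import Function.Bundles using (mk⇔)
open import Relation.Binary.Bundles using (DecTotalOrder)
import Relation.Binary.Construct.Flip.EqAndOrd as Flip
open import Relation.Binary.PropositionalEquality as ≡ using (_≡_; _≢_; cong; cong₂)
import Relation.Binary.Reasoning.Setoid as SetoidReasoning
open import Relation.Nullary.Decidable using (yes; no; ¬?)
open import Relation.Nullary.Negation using (contradiction)

-- Lists without repetitions, and concatenations of them.

-- In a duplicate-free list each element has only one membership proof, so equality as sets is
-- already equality as bags.
unique⇒↭ : ∀ {A : Set} {xs ys : List A} → Unique xs → Unique ys →
           (∀ {x} → x ∈ xs → x ∈ ys) → (∀ {x} → x ∈ ys → x ∈ xs) → xs ↭ ys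
unique⇒↭ xs! ys! xs⊆ys ys⊆xs = ∼bag⇒↭ (unique∧set⇒bag xs! ys! (mk⇔ xs⊆ys ys⊆xs))

concatMap-unique : ∀ {A B : Set} {g : A → List B} {xs} → Unique xs →
                   (∀ {x} → x ∈ xs → Unique (g x)) →
                   (∀ {x y v} → x ∈ xs → y ∈ xs → v ∈ g x → v ∈ g y → x ≡ y) →
                   Unique (concatMap g xs)
concatMap-unique [] _ _ = []
concatMap-unique {g = g} {x ∷ xs} (x∉xs ∷ xs!) g! disjoint =
  Unique.++⁺ (g! (here ≡.refl))
    (concatMap-unique xs! (g! ∘ there) (λ x∈ y∈ → disjoint (there x∈) (there y∈)))
    λ (v∈gx , v∈) → let y , y∈xs , v∈gy = find (∈-concatMap⁻ g v∈) in
      All.lookup x∉xs y∈xs (disjoint (here ≡.refl) (there y∈xs) v∈gx v∈gy)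

-- A cross-multiplied count, which avoids division. When it is applied to a `p` of length l + 1, `c`
-- is ∏ⱼ mₚ(j)!, `d` is l! and `f x` is mₚ(x).
length-concatMap-* : ∀ {A B : Set} (g : A → List B) (f : A → ℕ) c d xs →
                     (∀ {x} → x ∈ xs → length (g x) ℕ.* c ≡ f x ℕ.* d) →
                     length (concatMap g xs) ℕ.* c ≡ sum (map f xs) ℕ.* d
length-concatMap-* g f c d []       _  = ≡.refl
length-concatMap-* g f c d (x ∷ xs) eq = begin
  length (g x ++ concatMap g xs) ℕ.* c                ≡⟨ cong (ℕ._* c) (length-++ (g x)) ⟩
  (length (g x) ℕ.+ length (concatMap g xs)) ℕ.* c    ≡⟨ ℕ.*-distribʳ-+ c (length (g x)) _ ⟩
  length (g x) ℕ.* c ℕ.+ length (concatMap g xs) ℕ.* c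
    ≡⟨ cong₂ ℕ._+_ (eq (here ≡.refl)) (length-concatMap-* g f c d xs (eq ∘ there)) ⟩
  f x ℕ.* d ℕ.+ sum (map f xs) ℕ.* d                  ≡⟨ ℕ.*-distribʳ-+ d (f x) _ ⟨
  (f x ℕ.+ sum (map f xs)) ℕ.* d                      ∎
  where open ≡.≡-Reasoning

-- Folds over a commutative monoid.

module Fold {c ℓ} (M : CommutativeMonoid c ℓ) where
  open CommutativeMonoid M renaming (refl to ≈-refl; sym to ≈-sym; trans to ≈-trans)
  open CommutativeSemigroupProperties commutativeSemigroup using (x∙yz≈y∙xz)

  -- Unfolds to the same term as `sumOver`, `productOver` and the sums and products over
  -- `distinctParts`, so the lemmas below apply to all of them without conversion.
  fold : ∀ {A : Set} → (A → Carrier) → List A → Carrier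
  fold f xs = foldr _∙_ ε (map f xs)

  fold-cong : ∀ {A : Set} {f g : A → Carrier} xs → (∀ {x} → x ∈ xs → f x ≈ g x) →
              fold f xs ≈ fold g xs
  fold-cong []       _  = ≈-refl
  fold-cong (x ∷ xs) eq = ∙-cong (eq (here ≡.refl)) (fold-cong xs (eq ∘ there))

  fold-++ : ∀ {A : Set} (f : A → Carrier) xs ys → fold f (xs ++ ys) ≈ fold f xs ∙ fold f ys
  fold-++ f []       ys = ≈-sym (identityˡ _)
  fold-++ f (x ∷ xs) ys = ≈-trans (∙-congˡ (fold-++ f xs ys)) (≈-sym (assoc _ _ _))

  fold-concatMap : ∀ {A B : Set} (f : B → Carrier) (g : A → List B) xs →
                   fold f (concatMap g xs) ≈ fold (fold f ∘ g) xs
  fold-concatMap f g []       = ≈-refl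
  fold-concatMap f g (x ∷ xs) =
    ≈-trans (fold-++ f (g x) _) (∙-congˡ (fold-concatMap f g xs))

  fold-↭ : ∀ {A : Set} (f : A → Carrier) {xs ys} → xs ↭ ys → fold f xs ≈ fold f ys
  fold-↭ f refl           = ≈-refl
  fold-↭ f (prep x p)     = ∙-congˡ (fold-↭ f p)
  fold-↭ f (swap x y p)   = ≈-trans (x∙yz≈y∙xz _ _ _) (∙-congˡ (∙-congˡ (fold-↭ f p)))
  fold-↭ f (trans p q)    = ≈-trans (fold-↭ f p) (fold-↭ f q)

  -- Treats an old and a new part `y` alike: `distinctParts (y ∷ p)` is `y` followed by the filtered
  -- `distinctParts p`, and if `y` does not occur in `p`, its term there is neutral (0 in a sum, 0!
  -- = 1 in a product).
  fold-extract : ∀ (f : ℕ → Carrier) y {xs} → Unique xs → (y ∉ xs → f y ≈ ε) →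
                 fold f xs ≈ f y ∙ fold f (filter (¬? ∘ (y ≟_)) xs)
  fold-extract f y [] f[y]≈ε = ≈-sym (≈-trans (identityʳ _) (f[y]≈ε λ ()))
  fold-extract f y {x ∷ xs} (x∉xs ∷ xs!) f[y]≈ε with y ≟ x
  ... | yes ≡.refl = ∙-congˡ (reflexive (cong (fold f) (≡.sym
                       (≡.trans (filter-reject ≢y? (contradiction ≡.refl)) (filter-all ≢y? x∉xs)))))
    where ≢y? = ¬? ∘ (y ≟_)
  ... | no  y≢x    = begin
    f x ∙ fold f xs                      ≈⟨ ∙-congˡ (fold-extract f y xs! λ y∉xs → f[y]≈ε λ where
                                              (here y≡x)   → y≢x y≡x
                                              (there y∈xs) → y∉xs y∈xs) ⟩
    f x ∙ (f y ∙ fold f (filter ≢y? xs)) ≈⟨ x∙yz≈y∙xz _ _ _ ⟩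
    f y ∙ fold f (x ∷ filter ≢y? xs)     ≡⟨ cong (λ zs → f y ∙ fold f zs) (filter-accept ≢y? y≢x) ⟨
    f y ∙ fold f (filter ≢y? (x ∷ xs))   ∎
    where
    open SetoidReasoning setoid
    ≢y? = ¬? ∘ (y ≟_)

-- Multiplicities of parts.

module + = Fold +-0-commutativeMonoid
module * = Fold *-1-commutativeMonoid

distinct! : ∀ p → Unique (distinctParts p)
distinct! = deduplicate-! _≟_

multiplicity-∷≡ : ∀ y p → multiplicity (y ∷ p) y ≡ suc (multiplicity p y)
multiplicity-∷≡ y p = cong length (filter-accept (y ≟_) ≡.refl)

multiplicity-∷≢ : ∀ {y j} p → j ≢ y → multiplicity (y ∷ p) j ≡ multiplicity p j
multiplicity-∷≢ {j = j} p j≢y = cong length (filter-reject (j ≟_) j≢y)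

multiplicity-↭ : ∀ {p q} j → p ↭ q → multiplicity p j ≡ multiplicity q j
multiplicity-↭ j p↭q = ↭-length (filter-↭ (j ≟_) p↭q)

multiplicity-∉ : ∀ {p} j → j ∉ distinctParts p → multiplicity p j ≡ 0
multiplicity-∉ {p} j j∉ =
  cong length (filter-none (j ≟_) (¬Any⇒All¬ p (j∉ ∘ ∈-deduplicate⁺ _≟_)))

∈-filter-≢ : ∀ {y x : ℕ} xs → x ∈ filter (¬? ∘ (y ≟_)) xs → x ≢ y
∈-filter-≢ {y} xs x∈ x≡y = proj₂ (∈-filter⁻ (¬? ∘ (y ≟_)) {xs = xs} x∈) (≡.sym x≡y)

-- Prepending `y` raises the multiplicity of `y` by one and changes no other; `fold-extract`
-- reassembles the sum for `p`.
sum-multiplicities : ∀ p → sum (map (multiplicity p) (distinctParts p)) ≡ length p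
sum-multiplicities []      = ≡.refl
sum-multiplicities (y ∷ p) = begin
  multiplicity (y ∷ p) y ℕ.+ +.fold (multiplicity (y ∷ p)) rest
    ≡⟨ cong₂ ℕ._+_ (multiplicity-∷≡ y p)
         (+.fold-cong rest (multiplicity-∷≢ p ∘ ∈-filter-≢ (distinctParts p))) ⟩
  suc (multiplicity p y ℕ.+ +.fold (multiplicity p) rest)
    ≡⟨ cong suc (+.fold-extract _ y (distinct! p) (multiplicity-∉ y)) ⟨
  suc (+.fold (multiplicity p) (distinctParts p))
    ≡⟨ cong suc (sum-multiplicities p) ⟩
  suc (length p) ∎
  where
  open ≡.≡-Reasoning
  rest = filter (¬? ∘ (y ≟_)) (distinctParts p)

-- Only the factor of `y` changes, from m! to (m + 1)! = (m + 1) m!, where m = 0 if `y` is new.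
multiplicityFactorials-∷ : ∀ y p → multiplicityFactorials (y ∷ p) ≡
                           suc (multiplicity p y) ℕ.* multiplicityFactorials p
multiplicityFactorials-∷ y p = begin
  multiplicity (y ∷ p) y ! ℕ.* *.fold (λ j → multiplicity (y ∷ p) j !) rest
    ≡⟨ cong₂ ℕ._*_ (cong _! (multiplicity-∷≡ y p))
         (*.fold-cong rest (cong _! ∘ multiplicity-∷≢ p ∘ ∈-filter-≢ (distinctParts p))) ⟩
  suc (multiplicity p y) ℕ.* multiplicity p y ! ℕ.* *.fold (λ j → multiplicity p j !) rest
    ≡⟨ ℕ.*-assoc (suc (multiplicity p y)) (multiplicity p y !) _ ⟩
  suc (multiplicity p y) ℕ.* (multiplicity p y ! ℕ.* *.fold (λ j → multiplicity p j !) rest)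
    ≡⟨ cong (suc (multiplicity p y) ℕ.*_)
         (*.fold-extract _ y (distinct! p) (cong _! ∘ multiplicity-∉ y)) ⟨
  suc (multiplicity p y) ℕ.* multiplicityFactorials p ∎
  where
  open ≡.≡-Reasoning
  rest = filter (¬? ∘ (y ≟_)) (distinctParts p)

-- The factors agree one by one, but the distinct parts of `p` and `q` may be listed in different
-- orders, so the product is reordered as well.
multiplicityFactorials-↭ : ∀ {p q} → p ↭ q → multiplicityFactorials p ≡ multiplicityFactorials q
multiplicityFactorials-↭ {p} {q} p↭q = ≡.trans
  (*.fold-cong (distinctParts p) (λ {j} _ → cong _! (multiplicity-↭ j p↭q)))
  (*.fold-↭ _ (unique⇒↭ (distinct! p) (distinct! q) (transfer p↭q) (transfer (↭-sym p↭q))))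
  where
  transfer : ∀ {p q x} → p ↭ q → x ∈ distinctParts p → x ∈ distinctParts q
  transfer {p} p↭q = ∈-deduplicate⁺ _≟_ ∘ ∈-resp-↭ p↭q ∘ ∈-deduplicate⁻ _≟_ p

-- The distinct rearrangements of a list and their number.

remove : ℕ → List ℕ → List ℕ
remove x []       = []
remove x (y ∷ ys) with x ≟ y
... | yes _ = ys
... | no  _ = y ∷ remove x ys

remove-↭ : ∀ {x p} → x ∈ p → x ∷ remove x p ↭ p
remove-↭ {x} {y ∷ p} x∈ with x ≟ y | x∈
... | yes ≡.refl | _         = ↭-refl
... | no  x≢y    | here x≡y  = contradiction x≡y x≢y
... | no  _      | there x∈p = trans (swap x y ↭-refl) (prep y (remove-↭ x∈p))

-- The first argument is the length of the list to be rearranged.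
arrangements : ℕ → List ℕ → List (List ℕ)
arrangements zero    p = [ [] ]
arrangements (suc l) p =
  concatMap (λ x → map (x ∷_) (arrangements l (remove x p))) (distinctParts p)

-- Keeps the counter of `arrangements` in step with the list; the recursion runs on that counter
-- because `remove x p` is not a structural subterm of `p`.
length-remove : ∀ {x p l} → x ∈ p → length p ≡ suc l → length (remove x p) ≡ l
length-remove x∈p eq = suc-injective (≡.trans (↭-length (remove-↭ x∈p)) eq)

arrangements-sound : ∀ l {p q} → length p ≡ l → q ∈ arrangements l p → q ↭ p
arrangements-sound zero    {[]} _  (here ≡.refl) = ↭-refl
arrangements-sound (suc l) {p}  eq q∈
  with x , x∈ , q∈ₓ ← find (∈-concatMap⁻ _ {xs = distinctParts p} q∈)
  with q′ , q′∈ , ≡.refl ← ∈-map⁻ (x ∷_) q∈ₓ =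
  let x∈p = ∈-deduplicate⁻ _≟_ p x∈ in
  trans (prep x (arrangements-sound l (length-remove x∈p eq) q′∈)) (remove-↭ x∈p)

arrangements-complete : ∀ l {p q} → length p ≡ l → q ↭ p → q ∈ arrangements l p
arrangements-complete zero {q = []} eq q↭p = here ≡.refl
arrangements-complete zero {q = x ∷ q} eq q↭p with () ← ≡.trans (↭-length q↭p) eq
arrangements-complete (suc l) {q = []} eq q↭p with () ← ≡.trans (↭-length q↭p) eq
arrangements-complete (suc l) {q = x ∷ q} eq q↭p =
  let x∈p = ∈-resp-↭ q↭p (here ≡.refl) in
  ∈-concatMap⁺ _ (lose (∈-deduplicate⁺ _≟_ x∈p) (∈-map⁺ (x ∷_)
    (arrangements-complete l (length-remove x∈p eq)
      -- Both sides now begin with `x`, which cancels.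
      (drop-∷ (trans q↭p (↭-sym (remove-↭ x∈p)))))))

-- The branches are indexed by distinct first parts, and a list determines its first part, so no two
-- branches overlap.
arrangements-unique : ∀ l p → Unique (arrangements l p)
arrangements-unique zero    p = [] ∷ []
arrangements-unique (suc l) p = concatMap-unique (distinct! p)
  (λ {x} _ → Unique.map⁺ ∷-injectiveʳ (arrangements-unique l (remove x p)))
  λ {x} {y} _ _ v∈ˣ v∈ʸ →
    let _ , _ , v≡x∷ = ∈-map⁻ (x ∷_) v∈ˣ
        _ , _ , v≡y∷ = ∈-map⁻ (y ∷_) v∈ʸ
    in ∷-injectiveˡ (≡.trans (≡.sym v≡x∷) v≡y∷)

-- Each first part `x` contributes mₚ(x) l!, and the multiplicities add up to l + 1.
length-arrangements : ∀ l {p} → length p ≡ l →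
                      length (arrangements l p) ℕ.* multiplicityFactorials p ≡ l !
length-arrangements zero    {[]} _  = ≡.refl
length-arrangements (suc l) {p}  eq = begin
  length (arrangements (suc l) p) ℕ.* multiplicityFactorials p
    ≡⟨ length-concatMap-* _ (multiplicity p) _ (l !) (distinctParts p)
         (startingWith ∘ ∈-deduplicate⁻ _≟_ p) ⟩
  sum (map (multiplicity p) (distinctParts p)) ℕ.* l !
    ≡⟨ cong (ℕ._* l !) (≡.trans (sum-multiplicities p) eq) ⟩
  suc l ! ∎
  where
  open ≡.≡-Reasoning
  startingWith : ∀ {x} → x ∈ p →
    length (map (x ∷_) (arrangements l (remove x p))) ℕ.* multiplicityFactorials p ≡
    multiplicity p x ℕ.* l !
  startingWith {x} x∈p = begin
    length (map (x ∷_) (arrangements l p′)) ℕ.* multiplicityFactorials p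
      ≡⟨ cong₂ ℕ._*_ (length-map (x ∷_) (arrangements l p′))
           (multiplicityFactorials-↭ (↭-sym (remove-↭ x∈p))) ⟩
    N ℕ.* multiplicityFactorials (x ∷ p′)
      ≡⟨ cong (N ℕ.*_) (multiplicityFactorials-∷ x p′) ⟩
    N ℕ.* (suc (multiplicity p′ x) ℕ.* multiplicityFactorials p′)
      ≡⟨ x∙yz≈y∙xz N (suc (multiplicity p′ x)) _ ⟩
    suc (multiplicity p′ x) ℕ.* (N ℕ.* multiplicityFactorials p′)
      -- The first factor is the multiplicity of `x` in `x ∷ p′`, a permutation of `p`; the second
      -- is l! by induction.
      ≡⟨ cong₂ ℕ._*_
           (≡.trans (≡.sym (multiplicity-∷≡ x p′)) (multiplicity-↭ x (remove-↭ x∈p)))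
           (length-arrangements l (length-remove x∈p eq)) ⟩
    multiplicity p x ℕ.* l ! ∎
    where
    open CommutativeSemigroupProperties ℕ.*-commutativeSemigroup using (x∙yz≈y∙xz)
    p′ = remove x p
    N  = length (arrangements l p′)

rearrangements : List ℕ → List (List ℕ)
rearrangements p = arrangements (length p) p

-- The counting identity exhibits l(p)! as an exact multiple of the divisor, so integer division
-- returns the count.
μ≡length : ∀ p → μ p ≡ length (rearrangements p)
μ≡length p = ≡.trans (/-congˡ (≡.sym (length-arrangements (length p) {p} ≡.refl)))
                     (m*n/n≡m (length (rearrangements p)) (multiplicityFactorials p))
  where instance _ = multiplicityFactorials≢0 p

-- Compositions grouped by their decreasing rearrangement.

-- The order is flipped so that sorting upwards yields exactly `Linked _≥_`, the condition in
-- `IsPartition`.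
≥-decTotalOrder : DecTotalOrder _ _ _
≥-decTotalOrder = Flip.decTotalOrder ≤-decTotalOrder

open Sort ≥-decTotalOrder using (sort; sort-↭; sort-↗)

decreasing-↭⇒≡ : ∀ {p q} → Linked _≥_ p → Linked _≥_ q → p ↭ q → p ≡ q
decreasing-↭⇒≡ p↘ q↘ p↭q =
  Pointwise-≡⇒≡ (↗↭↗⇒≋ (DecTotalOrder.totalOrder ≥-decTotalOrder) p↘ q↘ (↭⇒↭ₛ p↭q))

IsComposition-↭ : ∀ {n c d} → c ↭ d → IsComposition n c → IsComposition n d
IsComposition-↭ c↭d (isComposition positive total) =
  isComposition (All-resp-↭ c↭d positive) (≡.trans (≡.sym (sum-↭ c↭d)) total)

-- A composition lies in the class of its sorted form. Classes are disjoint: partitions with a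
-- common rearrangement are permutations of each other, hence equal.
compositions-by-partition :
  ∀ n → elements (compositions n) ↭ concatMap rearrangements (elements (partitions n))
compositions-by-partition n = unique⇒↭ (unique (compositions n))
  (concatMap-unique (unique (partitions n)) (λ {p} _ → arrangements-unique (length p) p) disjoint)
  forth back
  where
  open IsPartition
  rearranges : ∀ {p c} → c ∈ rearrangements p → c ↭ p
  rearranges {p} = arrangements-sound (length p) ≡.refl

  disjoint : ∀ {p q c} → p ∈ elements (partitions n) → q ∈ elements (partitions n) →
             c ∈ rearrangements p → c ∈ rearrangements q → p ≡ q
  disjoint p∈ q∈ c∈ᵖ c∈ᑫ = decreasing-↭⇒≡
    (decreasing (sound (partitions n) p∈)) (decreasing (sound (partitions n) q∈))
    (trans (↭-sym (rearranges c∈ᵖ)) (rearranges c∈ᑫ))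

  forth : ∀ {c} → c ∈ elements (compositions n) →
          c ∈ concatMap rearrangements (elements (partitions n))
  forth {c} c∈ = ∈-concatMap⁺ rearrangements $ lose
    (complete (partitions n)
      (isPartition (IsComposition-↭ (↭-sym (sort-↭ c)) (sound (compositions n) c∈)) (sort-↗ c)))
    (arrangements-complete (length (sort c)) ≡.refl (↭-sym (sort-↭ c)))

  back : ∀ {c} → c ∈ concatMap rearrangements (elements (partitions n)) →
         c ∈ elements (compositions n)
  back c∈ = let p , p∈ , c∈ᵖ = find (∈-concatMap⁻ rearrangements {xs = elements (partitions n)} c∈) in
    complete (compositions n) (IsComposition-↭ (↭-sym (rearranges c∈ᵖ))
      (composition (sound (partitions n) p∈)))

-- Sums in the ring and the recursion for `B`.

module _ {r ℓ} (R : CommutativeRing r ℓ) where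
  open CommutativeRing R renaming (refl to ≈-refl; sym to ≈-sym; trans to ≈-trans)
  open AbelianGroupProperties +-abelianGroup
    using (⁻¹-∙-comm; ε⁻¹≈ε) renaming (inverseʳ-unique to -‿unique)
  open RingProperties ring using (-‿distribˡ-*)
  open Sum semiring using (sum⁺-syntax; sum-init-last; sum-cong-≋)
  open Mult semiring using () renaming (_×_ to _·_)
  open SetoidReasoning setoid
  module ∑ = Fold +-commutativeMonoid
  module ∏ = Fold *-commutativeMonoid

  ∑-cong : ∀ n {f g : ℕ → Carrier} → (∀ {h} → h ≤ n → f h ≈ g h) →
           ∑[ h ≤ n ] f (toℕ h) ≈ ∑[ h ≤ n ] g (toℕ h)
  ∑-cong n eq = sum-cong-≋ {suc n} (λ h → eq (toℕ≤pred[n] h))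

  ∑-last : ∀ (f : ℕ → Carrier) n →
           ∑[ h ≤ suc n ] f (toℕ h) ≈ ∑[ h ≤ n ] f (toℕ h) + f (suc n)
  ∑-last f n = ≈-trans (sum-init-last (f ∘ toℕ)) $ +-cong
    (sum-cong-≋ {suc n} (λ h → reflexive (cong f (toℕ-inject₁ h))))
    (reflexive (cong f (toℕ-fromℕ (suc n))))

  ∑-neg : ∀ n (f : ℕ → Carrier) → ∑[ h ≤ n ] (- f (toℕ h)) ≈ - (∑[ h ≤ n ] f (toℕ h))
  -- The one-term sum is `f 0 + 0#`, so the trailing zero must be negated too.
  ∑-neg zero    f = ≈-trans (+-congˡ (≈-sym ε⁻¹≈ε)) (⁻¹-∙-comm _ _)
  ∑-neg (suc n) f = ≈-trans (+-congˡ (∑-neg n (f ∘ suc))) (⁻¹-∙-comm _ _)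

  fold-const : ∀ {A : Set} {f : A → Carrier} {y} xs → (∀ {x} → x ∈ xs → f x ≈ y) →
               ∑.fold f xs ≈ length xs · y
  fold-const []       _  = ≈-refl
  fold-const (x ∷ xs) eq = +-cong (eq (here ≡.refl)) (fold-const xs (eq ∘ there))

  module _ (a : ℕ → Carrier) where
    weight : List ℕ → Carrier
    weight c = productOver R c (λ nᵢ → - a nᵢ)

    B : ℕ → Carrier
    B n = sumOver R (compositions n) weight

    fold-prepend : ∀ x cs → ∑.fold weight (map (x ∷_) cs) ≈ - a x * ∑.fold weight cs
    fold-prepend x []       = ≈-sym (zeroʳ _)
    fold-prepend x (c ∷ cs) = ≈-trans (+-congˡ (fold-prepend x cs)) (≈-sym (distribˡ _ _ _))

    -- The index `h` is what remains after the first part. The variable `k` makes the induction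
    -- follow `compositionsFrom`: first part `suc k` gives the top term, and larger first parts give
    -- the terms below it.
    compositionsFrom-sum : ∀ k m → ∑.fold weight (compositionsFrom k m) ≈
                           ∑[ h ≤ m ] (- a (suc k ℕ.+ (m ∸ toℕ h)) * B (toℕ h))
    -- The remainder is the empty composition, and `B 0` unfolds to `1# + 0#`.
    compositionsFrom-sum k zero = +-congʳ (*-cong
      (-‿cong (reflexive (cong (a ∘ suc) (≡.sym (ℕ.+-identityʳ k))))) (≈-sym (+-identityʳ 1#)))
    compositionsFrom-sum k (suc m) = begin
      ∑.fold weight (map (suc k ∷_) (compositionsFrom 0 m) ++ compositionsFrom (suc k) m)
        ≈⟨ ∑.fold-++ weight (map (suc k ∷_) (compositionsFrom 0 m)) _ ⟩
      ∑.fold weight (map (suc k ∷_) (compositionsFrom 0 m)) +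
        ∑.fold weight (compositionsFrom (suc k) m)
        -- `B (suc m)` is by definition the sum over `compositionsFrom 0 m`.
        ≈⟨ +-cong (fold-prepend (suc k) (compositionsFrom 0 m)) (compositionsFrom-sum (suc k) m) ⟩
      - a (suc k) * B (suc m) + ∑[ h ≤ m ] (- a (suc (suc k) ℕ.+ (m ∸ toℕ h)) * B (toℕ h))
        ≈⟨ +-comm _ _ ⟩
      ∑[ h ≤ m ] (- a (suc (suc k) ℕ.+ (m ∸ toℕ h)) * B (toℕ h)) + - a (suc k) * B (suc m)
        -- Moving the successor inside the truncated subtraction needs `h ≤ m`.
        ≈⟨ +-cong (∑-cong m λ {h} h≤m → term h (≡.trans (≡.sym (+-suc k (m ∸ h)))
             (cong (k ℕ.+_) (≡.sym (+-∸-assoc 1 h≤m)))))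
             (term (suc m) (≡.trans (≡.sym (ℕ.+-identityʳ k)) (cong (k ℕ.+_) (≡.sym (n∸n≡0 m))))) ⟩
      ∑[ h ≤ m ] (- a (suc k ℕ.+ (suc m ∸ toℕ h)) * B (toℕ h)) +
        - a (suc k ℕ.+ (suc m ∸ suc m)) * B (suc m)
        ≈⟨ ∑-last (λ h → - a (suc k ℕ.+ (suc m ∸ h)) * B h) m ⟨
      ∑[ h ≤ suc m ] (- a (suc k ℕ.+ (suc m ∸ toℕ h)) * B (toℕ h)) ∎
      where
      term : ∀ h {i j} → i ≡ j → - a (suc i) * B h ≈ - a (suc j) * B h
      term h ≡.refl = ≈-refl

    B-recursion : ∀ n → B (suc n) ≈ ∑[ h ≤ n ] (- a (suc n ∸ toℕ h) * B (toℕ h))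
    B-recursion n = ≈-trans (compositionsFrom-sum 0 n) $ ∑-cong n λ {h} h≤n →
      *-congʳ {B h} (-‿cong (reflexive (cong a (≡.sym (+-∸-assoc 1 h≤n)))))

    -- The weight is a commutative product, hence constant on the rearrangements of `p`, of which
    -- there are `μ p`.
    partition-sum : ∀ n → B n ≈ sumOver R (partitions n) (λ p → μ p · weight p)
    partition-sum n = begin
      B n
        ≈⟨ ∑.fold-↭ weight (compositions-by-partition n) ⟩
      ∑.fold weight (concatMap rearrangements ps)
        ≈⟨ ∑.fold-concatMap weight rearrangements ps ⟩
      ∑.fold (∑.fold weight ∘ rearrangements) ps
        ≈⟨ ∑.fold-cong ps (λ {p} _ → begin
             ∑.fold weight (rearrangements p)
               ≈⟨ fold-const (rearrangements p)
                    (∏.fold-↭ _ ∘ arrangements-sound (length p) ≡.refl) ⟩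
             length (rearrangements p) · weight p
               ≡⟨ cong (_· weight p) (μ≡length p) ⟨
             μ p · weight p ∎) ⟩
      sumOver R (partitions n) (λ p → μ p · weight p) ∎
      where ps = elements (partitions n)

    -- The recursion for `b` and the comparison with `B`.

    module _ (b : ℕ → Carrier) (a₀≈1 : a 0 ≈ 1#) (b₀≈1 : b 0 ≈ 1#)
             (inverse : ∀ n → ∑[ h ≤ n ] (a (n ∸ toℕ h) * b (toℕ h)) ≈ δ R 0 n) where

      -- In the convolution at `suc n` the last term is `a 0 * b (suc n)`, that is `b (suc n)`; the
      -- total is zero, so `b (suc n)` is the negative of the other terms.
      b-recursion : ∀ n → b (suc n) ≈ ∑[ h ≤ n ] (- a (suc n ∸ toℕ h) * b (toℕ h))
      b-recursion n = begin
        b (suc n)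
          ≈⟨ -‿unique _ _ (begin
               ∑[ h ≤ n ] (a (suc n ∸ toℕ h) * b (toℕ h)) + b (suc n)
                 ≈⟨ +-congˡ (≈-trans (*-congʳ (≈-trans (reflexive (cong a (n∸n≡0 n))) a₀≈1))
                              (*-identityˡ _)) ⟨
               ∑[ h ≤ n ] (a (suc n ∸ toℕ h) * b (toℕ h)) + a (suc n ∸ suc n) * b (suc n)
                 ≈⟨ ∑-last (λ h → a (suc n ∸ h) * b h) n ⟨
               ∑[ h ≤ suc n ] (a (suc n ∸ toℕ h) * b (toℕ h))
                 ≈⟨ inverse (suc n) ⟩
               0# ∎) ⟩
        - (∑[ h ≤ n ] (a (suc n ∸ toℕ h) * b (toℕ h)))
          ≈⟨ ∑-neg n (λ h → a (suc n ∸ h) * b h) ⟨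
        ∑[ h ≤ n ] (- (a (suc n ∸ toℕ h) * b (toℕ h)))
          ≈⟨ ∑-cong n (λ {h} _ → -‿distribˡ-* (a (suc n ∸ h)) (b h)) ⟩
        ∑[ h ≤ n ] (- a (suc n ∸ toℕ h) * b (toℕ h)) ∎

      -- Both sequences start at 1 and obey the same recursion, which refers to all earlier values;
      -- hence strong induction.
      b≈B : ∀ n → b n ≈ B n
      b≈B = <-rec _ λ where
        zero    _  → ≈-trans b₀≈1 (≈-sym (+-identityʳ 1#))
        (suc n) ih → begin
          b (suc n)                                     ≈⟨ b-recursion n ⟩
          ∑[ h ≤ n ] (- a (suc n ∸ toℕ h) * b (toℕ h))  ≈⟨ ∑-cong n (λ {h} h≤n → *-congˡ {x = - a (suc n ∸ h)} (ih (s≤s h≤n))) ⟩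
          ∑[ h ≤ n ] (- a (suc n ∸ toℕ h) * B (toℕ h))  ≈⟨ B-recursion n ⟨
          B (suc n)                                     ∎

theorem1 :
  ∀ {r ℓ} (R : CommutativeRing r ℓ) →
  let open CommutativeRing R
      open Sum semiring using (sum⁺-syntax)
      open Mult semiring using () renaming (_×_ to _·_)
  in
  (a b : ℕ → Carrier) →
  a 0 ≈ 1# →
  b 0 ≈ 1# →
  (∀ n → ∑[ h ≤ n ] (a (n ∸ toℕ h) * b (toℕ h)) ≈ δ R 0 n) →
  ∀ n → n > 0 →
    (b n ≈ sumOver R (compositions n) (λ c → productOver R c (λ nᵢ → - a nᵢ)))
    ×
    (b n ≈ sumOver R (partitions n) (λ p → μ p · productOver R p (λ nᵢ → - a nᵢ)))
theorem1 R a b a₀≈1 b₀≈1 inverse n _ =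
  b≈B R a b a₀≈1 b₀≈1 inverse n ,
  CommutativeRing.trans R (b≈B R a b a₀≈1 b₀≈1 inverse n) (partition-sum R a n)
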